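{- A tournament $T$ is $\vec C_3$-decomposable if and only if it has no copies of $T_5^8$, $T_5^{10}$ nor of $T_5^{12}$ (that is, no subtournament of $T$ induced by $5$ vertices is isomorphic to one of $T_5^8$, $T_5^{10}$, $T_5^{12}$).
   Context: A tournament is a finite directed graph without loops having exactly one arc between each pair of distinct vertices (the empty tournament is allowed). $V(T)$ and $A(T)$ are the vertex and arc sets, and $T|_W$ is the subtournament induced by $W\subset V(T)$. $\vec C_3$-decomposability is defined recursively. Every tournament of size $0$ or $1$ is $\vec C_3$-decomposable. A tournament $T$ of size $n\ge2$ is $\vec C_3$-decomposable if there exist pairwise disjoint (possibly empty) sets $A,B,C\subsetneq V(T)$ with $A\cup B\cup C=V(T)$, such that $T|_A,T|_B,T|_C$ are all $\vec C_3$-decomposable and $A\times B,\ B\times C,\ C\times A\subset A(T)$ (all arcs go from $A$ to $B$, from $B$ to $C$ and from $C$ to $A$). The forbidden tournaments are: - $T_5^8$: vertices $1,\dots,5$, arcs $1\to2,\ 1\to3,\ 1\to4,\ 2\to3,\ 2\to4,\ 2\to5,\ 3\to4,\ 4\to5,\ 5\to1,\ 5\to3$. - $T_5^{10}$: vertices $1,\dots,5$, arcs $1\to2,\ 1\to4,\ 2\to3,\ 2\to4,\ 3\to1,\ 3\to4,\ 3\to5,\ 4\to5,\ 5\to1,\ 5\to2$. - $T_5^{12}$: vertices $\mathbb{Z}_5$, arcs $i\to i+1$ and $i\to i+2$ for all $i$. -}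

module Defs where

open import Data.Fin using (Fin; toℕ)
open import Data.Fin.Properties using (all?) renaming (_≟_ to _≟ᶠ_)
open import Data.Fin.Subset using (Subset; _∈_; _⊂_; _∩_; _∪_; ∣_∣; Empty; ⊤)
open import Data.List using (List; []; _∷_)
import Data.List.Membership.Propositional as List
import Data.List.Membership.DecPropositional as DecList
open import Data.Nat using (ℕ; suc; _+_; _≤_; _%_; _≟_)
open import Data.Product using (_×_; _,_; Σ-syntax)
open import Data.Product.Properties using (≡-dec)
open import Data.Sum using (_⊎_)
open import Function.Bundles using (_⇔_)
open import Function.Definitions using (Injective)
open import Level using (0ℓ)
open import Relation.Binary using (Rel; Decidable; Trichotomous; Tri; tri<; tri≈; tri>)
open import Relation.Binary.PropositionalEquality using (_≡_)
open import Relation.Nullary using (Dec; yes; no)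
open import Relation.Nullary.Decidable using (True; toWitness; _⊎-dec_)

-- Trichotomy of the arc relation (which need not be transitive) says both that
-- there are no loops and that distinct vertices are joined by exactly one arc.

record Tournament (n : ℕ) : Set₁ where
  field
    Arc     : Rel (Fin n) 0ℓ
    compare : Trichotomous _≡_ Arc

module _ {n : ℕ} (T : Tournament n) where
  open Tournament T

  AllArcs : Subset n → Subset n → Set
  AllArcs A B = ∀ {a b} → a ∈ A → b ∈ B → Arc a b

  -- DecomposableOn W means that the subtournament induced by W is
  -- C₃-decomposable.  Subtournaments are represented by their vertex sets,
  -- since for A ⊆ W the restriction of T|_W to A is T|_A.

  data DecomposableOn (W : Subset n) : Set where
    small : ∣ W ∣ ≤ 1 → DecomposableOn W
    split : 2 ≤ ∣ W ∣ →
            (A B C : Subset n) →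
            A ⊂ W → B ⊂ W → C ⊂ W →
            Empty (A ∩ B) → Empty (B ∩ C) → Empty (C ∩ A) →
            A ∪ B ∪ C ≡ W →
            DecomposableOn A → DecomposableOn B → DecomposableOn C →
            AllArcs A B → AllArcs B C → AllArcs C A →
            DecomposableOn W

  C₃-Decomposable : Set
  C₃-Decomposable = DecomposableOn ⊤

-- A copy of S in T is an isomorphism from S onto the subtournament of T
-- induced by the image of f.

HasCopy : ∀ {k n} → Tournament k → Tournament n → Set
HasCopy {k} {n} S T =
  Σ[ f ∈ (Fin k → Fin n) ]
    Injective _≡_ _≡_ f ×
    (∀ i j → Tournament.Arc S i j ⇔ Tournament.Arc T (f i) (f j))

tri? : ∀ {A B C : Set} → Dec A → Dec B → Dec C → Dec (Tri A B C)
tri? (yes a) (no ¬b) (no ¬c) = yes (tri< a ¬b ¬c)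
tri? (no ¬a) (yes b) (no ¬c) = yes (tri≈ ¬a b ¬c)
tri? (no ¬a) (no ¬b) (yes c) = yes (tri> ¬a ¬b c)
tri? (no ¬a) (no ¬b) (no ¬c) =
  no λ { (tri< a _ _) → ¬a a ; (tri≈ _ b _) → ¬b b ; (tri> _ _ c) → ¬c c }
tri? (yes a) (yes b) _ =
  no λ { (tri< _ ¬b _) → ¬b b ; (tri≈ ¬a _ _) → ¬a a ; (tri> ¬a _ _) → ¬a a }
tri? (yes a) (no _) (yes c) =
  no λ { (tri< _ _ ¬c) → ¬c c ; (tri≈ ¬a _ _) → ¬a a ; (tri> ¬a _ _) → ¬a a }
tri? (no _) (yes b) (yes c) =
  no λ { (tri< _ ¬b _) → ¬b b ; (tri≈ _ _ ¬c) → ¬c c ; (tri> _ ¬b _) → ¬b b }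

trichotomous? : ∀ {n} {R : Rel (Fin n) 0ℓ} → Decidable R → Dec (Trichotomous _≡_ R)
trichotomous? R? = all? λ i → all? λ j → tri? (R? i j) (i ≟ᶠ j) (R? j i)

fromDecidable : ∀ {n} {R : Rel (Fin n) 0ℓ} (R? : Decidable R) →
                {True (trichotomous? R?)} → Tournament n
fromDecidable {R = R} R? {ok} = record { Arc = R ; compare = toWitness ok }

-- Arc lists use the vertex labels 1, …, n, so i : Fin n carries label suc (toℕ i).

Listed : ∀ {n} → List (ℕ × ℕ) → Rel (Fin n) 0ℓ
Listed arcs i j = (suc (toℕ i) , suc (toℕ j)) List.∈ arcs

listed? : ∀ {n} (arcs : List (ℕ × ℕ)) → Decidable (Listed {n} arcs)
listed? arcs i j = (suc (toℕ i) , suc (toℕ j)) ∈? arcs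
  where open DecList (≡-dec _≟_ _≟_) using (_∈?_)

T₅⁸ : Tournament 5
T₅⁸ = fromDecidable (listed?
  ( (1 , 2) ∷ (1 , 3) ∷ (1 , 4) ∷ (2 , 3) ∷ (2 , 4)
  ∷ (2 , 5) ∷ (3 , 4) ∷ (4 , 5) ∷ (5 , 1) ∷ (5 , 3) ∷ [] ))

T₅¹⁰ : Tournament 5
T₅¹⁰ = fromDecidable (listed?
  ( (1 , 2) ∷ (1 , 4) ∷ (2 , 3) ∷ (2 , 4) ∷ (3 , 1)
  ∷ (3 , 4) ∷ (3 , 5) ∷ (4 , 5) ∷ (5 , 1) ∷ (5 , 2) ∷ [] ))

-- Here i : Fin 5 stands for the residue class of toℕ i modulo 5.

Circulant : Rel (Fin 5) 0ℓ
Circulant i j = toℕ j ≡ (toℕ i + 1) % 5 ⊎ toℕ j ≡ (toℕ i + 2) % 5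

circulant? : Decidable Circulant
circulant? i j = (toℕ j ≟ (toℕ i + 1) % 5) ⊎-dec (toℕ j ≟ (toℕ i + 2) % 5)

T₅¹² : Tournament 5
T₅¹² = fromDecidable circulant?

{-# OPTIONS --safe #-}
module Submission where

-- Necessity: the forbidden tournaments have no nontrivial decomposition of
-- their own, so a copy of one of them lies in a single part of every splitting,
-- and descends to the small parts.
--
-- Sufficiency: grow three nonempty cyclically joined sets A → B → C → A inside
-- a vertex set U.  If an outside vertex v is neither a source nor a sink over
-- W = A ∪ B ∪ C, then v fits in one of the three sets: if it has both in- and
-- out-neighbours in A, say, then every (b , c) ∈ B × C has v → b and c → v,
-- since otherwise v, b, c and the two neighbours form a forbidden tournament.
-- If no such v exists and W ≠ U, then either U falls into two parts with all arcs from
-- one to the other, or there are outside vertices o → W → i with i → o, and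
-- ({o} , W , {i}) is a larger cyclic triple.  The latter step applied to a
-- one-vertex W starts the process.

open import Defs
open import Data.Empty renaming (⊥-elim to explode) using ()
open import Data.Fin using (Fin)
open import Data.Fin.Patterns using (0F; 1F; 2F)
open import Data.Fin.Properties using (any?; all?) renaming (_≟_ to _≟ᶠ_)
open import Data.Fin.Subset
open import Data.Fin.Subset.Induction using (⊂-wellFounded; ⊃-wellFounded; Acc; acc)
open import Data.Fin.Subset.Properties
open import Data.List using (List; allFin; cartesianProduct; filter)
open import Data.List.Membership.Propositional renaming (_∈_ to _∈ˡ_) using ()
open import Data.List.Membership.Propositional.Properties
  using (∈-filter⁺; ∈-cartesianProduct⁺; ∈-allFin)
open import Data.List.Relation.Unary.All using (All; []; _∷_) renaming (lookup to All-lookup)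
open import Data.Nat using (ℕ; suc; _≤_; z≤n)
open import Data.Nat.Properties using (≤-trans; ≤-reflexive; <⇒≱)
open import Data.Product using (_×_; _,_; proj₁; proj₂; ∃-syntax)
open import Data.Sum using (_⊎_; inj₁; inj₂; [_,_]′)
open import Data.Vec using (Vec; []; _∷_; lookup; tabulate)
open import Data.Vec.Properties using (lookup∘tabulate; lookup⇒[]=; []=⇒lookup)
open import Function using (_∘_; case_of_)
open import Function.Bundles using (_⇔_; mk⇔; Equivalence)
open import Function.Definitions using (Injective)
open import Relation.Binary using (tri<; tri≈; tri>)
open import Relation.Binary.PropositionalEquality
  using (_≡_; _≢_; refl; sym; trans; subst)
open import Relation.Nullary using (Dec; yes; no; ¬_; does)
open import Relation.Nullary.Decidable
  using (toWitness; dec-true; ¬?; _×-dec_; _→-dec_)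
open import Relation.Unary using (Decidable)

-- Subsets of a finite set

module _ {n : ℕ} where

  select : {P : Fin n → Set} → Decidable P → Subset n
  select P? = tabulate (does ∘ P?)

  ∈-select⁺ : ∀ {P : Fin n → Set} (P? : Decidable P) {x} → P x → x ∈ select P?
  ∈-select⁺ P? {x} px =
    lookup⇒[]= x _ (trans (lookup∘tabulate _ x) (dec-true (P? x) px))

  ∈-select⁻ : ∀ {P : Fin n → Set} (P? : Decidable P) {x} → x ∈ select P? → P x
  ∈-select⁻ P? {x} x∈ with P? x | trans (sym (lookup∘tabulate (does ∘ P?) x)) ([]=⇒lookup x∈)
  ... | yes px | _ = px

  ∈₁ : ∀ (A B C : Subset n) → A ⊆ A ∪ B ∪ C
  ∈₁ A B C = p⊆p∪q (B ∪ C)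

  ∈₂ : ∀ (A B C : Subset n) → B ⊆ A ∪ B ∪ C
  ∈₂ A B C = q⊆p∪q A (B ∪ C) ∘ p⊆p∪q C

  ∈₃ : ∀ (A B C : Subset n) → C ⊆ A ∪ B ∪ C
  ∈₃ A B C = q⊆p∪q A (B ∪ C) ∘ q⊆p∪q B C

  ∪₃-elim : ∀ (A B C : Subset n) {x} {P : Set} → x ∈ A ∪ B ∪ C →
            (x ∈ A → P) → (x ∈ B → P) → (x ∈ C → P) → P
  ∪₃-elim A B C x∈ f g h =
    [ f , [ g , h ]′ ∘ x∈p∪q⁻ B C ]′ (x∈p∪q⁻ A (B ∪ C) x∈)

  ∪-rotate : ∀ (A B C : Subset n) → B ∪ C ∪ A ≡ A ∪ B ∪ C
  ∪-rotate A B C = trans (sym (∪-assoc B C A)) (∪-comm (B ∪ C) A)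

  x∈⁅x⁆∪p : ∀ (x : Fin n) A → x ∈ ⁅ x ⁆ ∪ A
  x∈⁅x⁆∪p x A = p⊆p∪q A (x∈⁅x⁆ x)

  ∈⁅⁆-subst : ∀ {v x : Fin n} (P : Fin n → Set) → P v → x ∈ ⁅ v ⁆ → P x
  ∈⁅⁆-subst {v} P pv x∈ = subst P (sym (x∈⁅y⁆⇒x≡y v x∈)) pv

  ∈⁅⁆∪-elim : ∀ {v x : Fin n} (A : Subset n) (P : Fin n → Set) →
              x ∈ ⁅ v ⁆ ∪ A → P v → (x ∈ A → P x) → P x
  ∈⁅⁆∪-elim {v} A P x∈ pv f = [ ∈⁅⁆-subst P pv , f ]′ (x∈p∪q⁻ ⁅ v ⁆ A x∈)

-- Arcs and copies

module Arcs {n : ℕ} (T : Tournament n) where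
  open Tournament T public using (Arc; compare)

  asym : ∀ {i j} → Arc i j → ¬ Arc j i
  asym {i} {j} ij with compare i j
  ... | tri< _ _ ¬ji = ¬ji
  ... | tri≈ ¬ij _ _ = explode (¬ij ij)
  ... | tri> ¬ij _ _ = explode (¬ij ij)

  arc? : ∀ i j → Dec (Arc i j)
  arc? i j with compare i j
  ... | tri< ij _ _  = yes ij
  ... | tri≈ ¬ij _ _ = no ¬ij
  ... | tri> ¬ij _ _ = no ¬ij

  irrefl : ∀ {i j} → i ≡ j → ¬ Arc i j
  irrefl refl ii = asym ii ii

  connex : ∀ {i j} → i ≢ j → ¬ Arc j i → Arc i j
  connex {i} {j} i≢j ¬ji with compare i j
  ... | tri< ij _ _  = ij
  ... | tri≈ _ i≡j _ = explode (i≢j i≡j)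
  ... | tri> _ _ ji  = explode (¬ji ji)

  -- For a concrete five-vertex tournament this computes to ten pairs, so a copy can be certified by
  -- ten arc proofs in a row.
  arcs : List (Fin n × Fin n)
  arcs = filter (λ (i , j) → arc? i j) (cartesianProduct (allFin n) (allFin n))

  ∈-arcs : ∀ {i j} → Arc i j → (i , j) ∈ˡ arcs
  ∈-arcs {i} {j} = ∈-filter⁺ (λ (i , j) → arc? i j) (∈-cartesianProduct⁺ (∈-allFin i) (∈-allFin j))

module _ {k n : ℕ} (S : Tournament k) (T : Tournament n) where
  private
    module S = Arcs S
    module T = Arcs T

  -- The arcs of S are listed in lexicographic order of their endpoints.
  copy : (xs : Vec (Fin n) k) →
         All (λ (i , j) → T.Arc (lookup xs i) (lookup xs j)) S.arcs → HasCopy S T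
  copy xs all = lookup xs , injective , λ i j → mk⇔ preserves (reflects i j)
    where
    preserves : ∀ {i j} → S.Arc i j → T.Arc (lookup xs i) (lookup xs j)
    preserves ij = All-lookup all (S.∈-arcs ij)

    injective : Injective _≡_ _≡_ (lookup xs)
    -- Distinct vertices of `S` are joined by an arc; were their images equal, it would become a
    -- loop in `T`.
    injective {i} {j} eq with S.compare i j
    ... | tri< ij _ _  = explode (T.irrefl eq (preserves ij))
    ... | tri≈ _ i≡j _ = i≡j
    ... | tri> _ _ ji  = explode (T.irrefl (sym eq) (preserves ji))

    reflects : ∀ i j → T.Arc (lookup xs i) (lookup xs j) → S.Arc i j
    reflects i j ij with S.compare i j
    ... | tri< s _ _    = s
    ... | tri≈ _ refl _ = explode (T.irrefl refl ij)
    ... | tri> _ _ ji   = explode (T.asym ij (preserves ji))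

-- Necessity: rigidity of the forbidden tournaments

-- The cyclic order of the three parts of a splitting.
next : Fin 3 → Fin 3
next 0F = 1F
next 1F = 2F
next 2F = 0F

module _ (S : Tournament 5) where
  open Arcs S

  Respects : Vec (Fin 3) 5 → Set
  Respects c = ∀ i j → lookup c j ≡ next (lookup c i) → Arc i j

  Constant : Vec (Fin 3) 5 → Set
  Constant c = ∀ i → lookup c i ≡ lookup c 0F

  Rigid : Set
  Rigid = ∀ a b c d e → let col = a ∷ b ∷ c ∷ d ∷ e ∷ [] in Respects col → Constant col

  rigid? : Dec Rigid
  rigid? = all? λ a → all? λ b → all? λ c → all? λ d → all? λ e →
    let col = a ∷ b ∷ c ∷ d ∷ e ∷ [] in
    (all? λ i → all? λ j → (lookup col j ≟ᶠ next (lookup col i)) →-dec arc? i j)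
      →-dec (all? λ i → lookup col i ≟ᶠ lookup col 0F)

rigid₈ : Rigid T₅⁸
rigid₈ = toWitness {a? = rigid? T₅⁸} _

rigid₁₀ : Rigid T₅¹⁰
rigid₁₀ = toWitness {a? = rigid? T₅¹⁰} _

rigid₁₂ : Rigid T₅¹²
rigid₁₂ = toWitness {a? = rigid? T₅¹²} _

two-elements : ∀ {n} {W : Subset n} {x y} → x ∈ W → y ∈ W → x ≢ y → 2 ≤ ∣ W ∣
two-elements {W = W} {x} {y} x∈W y∈W x≢y =
  subst (λ k → suc k ≤ ∣ W ∣) (∣⁅x⁆∣≡1 x)
    (p⊂q⇒∣p∣<∣q∣
      (∈⁅⁆-subst (_∈ W) x∈W , y , y∈W , λ y∈ → x≢y (sym (x∈⁅y⁆⇒x≡y x y∈))))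

module _ {n : ℕ} (S : Tournament 5) (rigid : Rigid S) (T : Tournament n)
         (f : Fin 5 → Fin n) (f-injective : Injective _≡_ _≡_ f)
         (f-arc : ∀ i j → Tournament.Arc S i j ⇔ Tournament.Arc T (f i) (f j)) where

  no-copy-inside : ∀ {W} → DecomposableOn T W → ¬ (∀ i → f i ∈ W)
  no-copy-inside (small ∣W∣≤1) f∈W =
    <⇒≱ (two-elements (f∈W 0F) (f∈W 1F) (λ eq → case f-injective eq of λ ())) ∣W∣≤1
  no-copy-inside (split _ A B C _ _ _ _ _ _ A∪B∪C≡W dA dB dC AB BC CA) f∈W =
    -- By rigidity all five vertices have the colour of the first one, so the induction continues in
    -- that part.
    descend (lookup col 0F)
      (λ i → subst (λ c → f i ∈ part c) (rigid _ _ _ _ _ respects i) (f∈part i))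
    where
    part : Fin 3 → Subset n
    part 0F = A
    part 1F = B
    part 2F = C

    part-arcs : ∀ c → AllArcs T (part c) (part (next c))
    part-arcs 0F = AB
    part-arcs 1F = BC
    part-arcs 2F = CA

    colour : ∀ i → ∃[ c ] f i ∈ part c
    colour i = ∪₃-elim A B C (subst (f i ∈_) (sym A∪B∪C≡W) (f∈W i)) (0F ,_) (1F ,_) (2F ,_)

    col : Vec (Fin 3) 5
    col = tabulate (proj₁ ∘ colour)

    f∈part : ∀ i → f i ∈ part (lookup col i)
    f∈part i = subst (λ c → f i ∈ part c) (sym (lookup∘tabulate (proj₁ ∘ colour) i))
                 (proj₂ (colour i))

    respects : Respects S col
    respects i j eq = Equivalence.from (f-arc i j)
      (part-arcs (lookup col i) (f∈part i) (subst (λ c → f j ∈ part c) eq (f∈part j)))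

    descend : ∀ c → ¬ (∀ i → f i ∈ part c)
    descend 0F = no-copy-inside dA
    descend 1F = no-copy-inside dB
    descend 2F = no-copy-inside dC

decomposable⇒¬copy : ∀ {n} {S : Tournament 5} {T : Tournament n} → Rigid S →
                     C₃-Decomposable T → ¬ HasCopy S T
decomposable⇒¬copy {S = S} {T} rigid d (f , f-injective , f-arc) =
  no-copy-inside S rigid T f f-injective f-arc d (λ _ → ∈⊤)

-- Splittings, cyclic triples and modules

module _ {n : ℕ} (T : Tournament n) where
  open Arcs T

  -- Parts may be empty. Their pairwise disjointness comes from the arc conditions through
  -- `disjoint`: a common vertex would carry a loop.
  record Splitting (U : Subset n) : Set where
    field
      A B C   : Subset n
      A⊂U     : A ⊂ U
      B⊂U     : B ⊂ U
      C⊂U     : C ⊂ U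
      union   : A ∪ B ∪ C ≡ U
      A⇒B     : AllArcs T A B
      B⇒C     : AllArcs T B C
      C⇒A     : AllArcs T C A

  -- Nonemptiness makes each part a proper subset of the union, since the next part has a vertex
  -- outside it.
  record Triangle (A B C : Subset n) : Set where
    field
      A⇒B : AllArcs T A B
      B⇒C : AllArcs T B C
      C⇒A : AllArcs T C A
      a∈A : Nonempty A
      b∈B : Nonempty B
      c∈C : Nonempty C

  record Larger (U W : Subset n) : Set where
    constructor larger
    field
      {A B C}  : Subset n
      triangle : Triangle A B C
      grows    : W ⊂ A ∪ B ∪ C
      within   : A ∪ B ∪ C ⊆ U

  -- W is a module of T|_U: an outside vertex is a source or a sink over W.
  Module : Subset n → Subset n → Set
  Module U W = ∀ {v p q} → v ∈ U → v ∉ W → p ∈ W → q ∈ W → Arc p v → ¬ Arc v q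

  disjoint : ∀ {A B} → AllArcs T A B → ∀ {x} → x ∈ A → x ∉ B
  disjoint A⇒B x∈A x∈B = irrefl refl (A⇒B x∈A x∈B)

  rotate : ∀ {A B C} → Triangle A B C → Triangle B C A
  rotate t = record { A⇒B = B⇒C ; B⇒C = C⇒A ; C⇒A = A⇒B ; a∈A = b∈B ; b∈B = c∈C ; c∈C = a∈A }
    where open Triangle t

  splitting-of-triangle : ∀ {A B C} → Triangle A B C → Splitting (A ∪ B ∪ C)
  splitting-of-triangle {A} {B} {C} t = record
    { A⊂U = ∈₁ A B C , proj₁ b∈B , ∈₂ A B C (proj₂ b∈B)
          , λ b∈A → disjoint A⇒B b∈A (proj₂ b∈B)
    ; B⊂U = ∈₂ A B C , proj₁ c∈C , ∈₃ A B C (proj₂ c∈C)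
          , λ c∈B → disjoint B⇒C c∈B (proj₂ c∈C)
    ; C⊂U = ∈₃ A B C , proj₁ a∈A , ∈₁ A B C (proj₂ a∈A)
          , λ a∈C → disjoint C⇒A a∈C (proj₂ a∈A)
    ; union = refl ; A⇒B = A⇒B ; B⇒C = B⇒C ; C⇒A = C⇒A }
    where open Triangle t

  -- With the third part empty, the arc conditions involving it are vacuous.
  bipartition : ∀ {U X y} → X ⊆ U → Nonempty X → y ∈ U → y ∉ X →
                (∀ {a b} → a ∈ X → b ∈ U → b ∉ X → Arc a b) → Splitting U
  bipartition {U} {X} {y} X⊆U (x , x∈X) y∈U y∉X X⇒ = record
    { A = X ; B = Y ; C = ⊥
    ; A⊂U = X⊆U , y , y∈U , y∉X
    ; B⊂U = Y⊆U , x , X⊆U x∈X , λ x∈Y → Y∌ x∈Y x∈X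
    ; C⊂U = (λ z∈⊥ → explode (∉⊥ z∈⊥)) , y , y∈U , ∉⊥
    ; union = ⊆-antisym
        (λ z∈ → ∪₃-elim X Y ⊥ z∈ X⊆U Y⊆U (λ z∈⊥ → explode (∉⊥ z∈⊥)))
        (λ {z} z∈U → case z ∈? X of λ where
          (yes z∈X) → ∈₁ X Y ⊥ z∈X
          (no z∉X)  → ∈₂ X Y ⊥ (x∈p∩q⁺ (z∈U , x∉p⇒x∈∁p z∉X)))
    ; A⇒B = λ a∈X b∈Y → X⇒ a∈X (Y⊆U b∈Y) (Y∌ b∈Y)
    ; B⇒C = λ _ c∈⊥ → explode (∉⊥ c∈⊥)
    ; C⇒A = λ c∈⊥ _ → explode (∉⊥ c∈⊥) }
    where
    Y : Subset n
    Y = U ∩ ∁ X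

    Y⊆U : Y ⊆ U
    Y⊆U = p∩q⊆p U (∁ X)

    Y∌ : ∀ {z} → z ∈ Y → z ∉ X
    Y∌ = x∈∁p⇒x∉p ∘ p∩q⊆q U (∁ X)

  module _ {U W : Subset n} (W⊆U : W ⊆ U) {w : Fin n} (w∈W : w ∈ W) (mod : Module U W) where
    private
      -- Since `W` is a module, the arc between `v` and the single vertex `w` fixes the direction of
      -- all arcs between `v` and `W`.
      Outer Inner : Fin n → Set
      Outer v = v ∈ U × v ∉ W × Arc v w
      Inner v = v ∈ U × v ∉ W × Arc w v

      outer? : Decidable Outer
      outer? v = v ∈? U ×-dec ¬? (v ∈? W) ×-dec arc? v w

      inner? : Decidable Inner
      inner? v = v ∈? U ×-dec ¬? (v ∈? W) ×-dec arc? w v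

      outer-all : ∀ {o b} → Outer o → b ∈ W → Arc o b
      outer-all (o∈U , o∉W , ow) b∈W =
        connex (λ { refl → o∉W b∈W }) (λ bo → mod o∈U o∉W b∈W w∈W bo ow)

      inner-all : ∀ {i b} → Inner i → b ∈ W → Arc b i
      inner-all (i∈U , i∉W , wi) b∈W =
        connex (λ { refl → i∉W b∈W }) (λ ib → mod i∈U i∉W w∈W b∈W wi ib)

      inner-of : ∀ {v} → v ∈ U → v ∉ W → ¬ Outer v → Inner v
      inner-of v∈U v∉W ¬out =
        v∈U , v∉W , connex (λ { refl → v∉W w∈W }) (λ vw → ¬out (v∈U , v∉W , vw))

      back? : Dec (∃[ i ] ∃[ o ] (Inner i × Outer o × Arc i o))
      back? = any? λ i → any? λ o → inner? i ×-dec outer? o ×-dec arc? i o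

      enclose : ∀ {i o} → Inner i → Outer o → Arc i o → Larger U W
      enclose {i} {o} inn@(i∈U , i∉W , wi) out@(o∈U , o∉W , ow) io = larger
        (record { A⇒B = λ a∈ b∈W → outer-all (∈⁅⁆-subst Outer out a∈) b∈W
                ; B⇒C = λ b∈W c∈ → inner-all (∈⁅⁆-subst Inner inn c∈) b∈W
                ; C⇒A = λ c∈ a∈ → ∈⁅⁆-subst (λ c → Arc c _) (∈⁅⁆-subst (Arc i) io a∈) c∈
                ; a∈A = o , x∈⁅x⁆ o
                ; b∈B = w , w∈W
                ; c∈C = i , x∈⁅x⁆ i })
        (∈₂ ⁅ o ⁆ W ⁅ i ⁆ , o , ∈₁ ⁅ o ⁆ W ⁅ i ⁆ (x∈⁅x⁆ o) , o∉W)
        (λ z∈ → ∪₃-elim ⁅ o ⁆ W ⁅ i ⁆ z∈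
                  (∈⁅⁆-subst (_∈ U) o∈U) W⊆U (∈⁅⁆-subst (_∈ U) i∈U))

    -- An arc from an inner to an outer vertex closes a cyclic triple around `W`. Without one, the
    -- outer vertices dominate the rest of `U`; if there are none, `W` dominates the rest.
    extend-module : ∀ {x} → x ∈ U → x ∉ W → Splitting U ⊎ Larger U W
    extend-module {x} x∈U x∉W with back? | any? outer?
    ... | yes (_ , _ , inn , out , io) | _ = inj₂ (enclose inn out io)
    ... | no _ | no ¬outer = inj₁ (bipartition W⊆U (w , w∈W) x∈U x∉W
          λ a∈W b∈U b∉W → inner-all (inner-of b∈U b∉W (λ out → ¬outer (_ , out))) a∈W)
    ... | no ¬back | yes (o , out) = inj₁ (bipartition
          (proj₁ ∘ ∈-select⁻ outer?) (o , ∈-select⁺ outer? out)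
          (W⊆U w∈W) (λ w∈ → proj₁ (proj₂ (∈-select⁻ outer? w∈)) w∈W)
          λ {a} {b} a∈ b∈U b∉ → separated (∈-select⁻ outer? a∈) b∈U (b∉ ∘ ∈-select⁺ outer?))
      where
      separated : ∀ {a b} → Outer a → b ∈ U → ¬ Outer b → Arc a b
      separated {a} {b} out b∈U ¬out with b ∈? W
      ... | yes b∈W = outer-all out b∈W
      ... | no b∉W  = connex (λ { refl → ¬out out })
                        (λ ba → ¬back (_ , _ , inner-of b∈U b∉W ¬out , out , ba))

  -- Sufficiency: absorbing vertices into a cyclic triple

  module _ (no₈ : ¬ HasCopy T₅⁸ T) (no₁₀ : ¬ HasCopy T₅¹⁰ T) (no₁₂ : ¬ HasCopy T₅¹² T) where

    -- Only the arcs `v`-`b`, `v`-`c` and `p`-`q` are undetermined. Each of the six orientations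
    -- violating the conclusion gives a forbidden tournament, whose vertices in order are the
    -- entries of the vector.
    mixed-fits : ∀ {v p q b c} → Arc p v → Arc v q → Arc p b → Arc q b → Arc b c →
                 Arc c p → Arc c q → Arc v b × Arc c v
    mixed-fits {v} {p} {q} {b} {c} pv vq pb qb bc cp cq
      with compare v b | compare v c | compare p q
    ... | tri< vb _ _ | tri> _ _ cv | _ = vb , cv
    ... | tri≈ _ refl _ | _ | _ = explode (asym vq qb)
    ... | _ | tri≈ _ refl _ | _ = explode (asym pv cp)
    ... | _ | _ | tri≈ _ refl _ = explode (asym pv vq)
    ... | tri< vb _ _ | tri< vc _ _ | tri< pq _ _ = explode (no₈
          (copy T₅⁸ T (p ∷ v ∷ q ∷ b ∷ c ∷ [])
            (pv ∷ pq ∷ pb ∷ vq ∷ vb ∷ vc ∷ qb ∷ bc ∷ cp ∷ cq ∷ [])))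
    ... | tri< vb _ _ | tri< vc _ _ | tri> _ _ qp = explode (no₁₀
          (copy T₅¹⁰ T (q ∷ p ∷ v ∷ b ∷ c ∷ [])
            (qp ∷ qb ∷ pv ∷ pb ∷ vq ∷ vb ∷ vc ∷ bc ∷ cq ∷ cp ∷ [])))
    ... | tri> _ _ bv | tri> _ _ cv | tri< pq _ _ = explode (no₈
          (copy T₅⁸ T (c ∷ p ∷ v ∷ q ∷ b ∷ [])
            (cp ∷ cv ∷ cq ∷ pv ∷ pq ∷ pb ∷ vq ∷ qb ∷ bc ∷ bv ∷ [])))
    ... | tri> _ _ bv | tri> _ _ cv | tri> _ _ qp = explode (no₁₀
          (copy T₅¹⁰ T (p ∷ b ∷ c ∷ v ∷ q ∷ [])
            (pb ∷ pv ∷ bc ∷ bv ∷ cp ∷ cv ∷ cq ∷ vq ∷ qp ∷ qb ∷ [])))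
    ... | tri> _ _ bv | tri< vc _ _ | tri< pq _ _ = explode (no₁₀
          (copy T₅¹⁰ T (v ∷ c ∷ p ∷ q ∷ b ∷ [])
            (vc ∷ vq ∷ cp ∷ cq ∷ pv ∷ pq ∷ pb ∷ qb ∷ bv ∷ bc ∷ [])))
    ... | tri> _ _ bv | tri< vc _ _ | tri> _ _ qp = explode (no₁₂
          (copy T₅¹² T (v ∷ c ∷ q ∷ p ∷ b ∷ [])
            (vc ∷ vq ∷ cq ∷ cp ∷ qp ∷ qb ∷ pv ∷ pb ∷ bv ∷ bc ∷ [])))

    Source Sink Mixed : Fin n → Subset n → Set
    Source v X = ∀ {x} → x ∈ X → Arc v x
    Sink v X = ∀ {x} → x ∈ X → Arc x v
    Mixed v X = ∃[ p ] ∃[ q ] (p ∈ X × q ∈ X × Arc p v × Arc v q)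

    mixed? : ∀ v X → Dec (Mixed v X)
    mixed? v X = any? λ p → any? λ q → p ∈? X ×-dec q ∈? X ×-dec arc? p v ×-dec arc? v q

    profile : ∀ {v X} → v ∉ X → Source v X ⊎ Sink v X ⊎ Mixed v X
    profile {v} {X} v∉X with any? (λ p → p ∈? X ×-dec arc? p v) | any? (λ q → q ∈? X ×-dec arc? v q)
    ... | no ¬in | _ = inj₁ λ x∈X → connex (λ { refl → v∉X x∈X }) (λ xv → ¬in (_ , x∈X , xv))
    ... | _ | no ¬out =
          inj₂ (inj₁ λ x∈X → connex (λ { refl → v∉X x∈X }) (λ vx → ¬out (_ , x∈X , vx)))
    ... | yes (p , p∈X , pv) | yes (q , q∈X , vq) = inj₂ (inj₂ (p , q , p∈X , q∈X , pv , vq))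

    -- Arcs between `v` and `A` are unconstrained, so `v` can be added to `A`. The equation with `W`
    -- lets rotated triples share one vertex set.
    join : ∀ {U W A B C v} → Triangle A B C → A ∪ B ∪ C ≡ W → W ⊆ U → v ∈ U → v ∉ W →
           Source v B → Sink v C → Larger U W
    join {U} {A = A} {B} {C} {v} t refl W⊆U v∈U v∉W v⇒B C⇒v = larger
      (record { A⇒B = λ a∈ b∈B → ∈⁅⁆∪-elim A (λ a → Arc a _) a∈ (v⇒B b∈B) (λ a∈A → A⇒B a∈A b∈B)
              ; B⇒C = B⇒C
              ; C⇒A = λ c∈C a∈ → ∈⁅⁆∪-elim A (Arc _) a∈ (C⇒v c∈C) (C⇒A c∈C)
              ; a∈A = v , v∈A⁺
              ; b∈B = b∈B
              ; c∈C = c∈C })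
      ( (λ z∈ → ∪₃-elim A B C z∈ (∈₁ A⁺ B C ∘ q⊆p∪q ⁅ v ⁆ A) (∈₂ A⁺ B C) (∈₃ A⁺ B C))
      , v , ∈₁ A⁺ B C v∈A⁺ , v∉W )
      (λ z∈ → ∪₃-elim A⁺ B C z∈ (λ z∈A⁺ → ∈⁅⁆∪-elim A (_∈ U) z∈A⁺ v∈U (W⊆U ∘ ∈₁ A B C))
                (W⊆U ∘ ∈₂ A B C) (W⊆U ∘ ∈₃ A B C))
      where
      open Triangle t

      A⁺ : Subset n
      A⁺ = ⁅ v ⁆ ∪ A

      v∈A⁺ : v ∈ A⁺
      v∈A⁺ = x∈⁅x⁆∪p v A

    join-mixed : ∀ {U W A B C v} → Triangle A B C → A ∪ B ∪ C ≡ W → W ⊆ U → v ∈ U → v ∉ W →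
                 Mixed v A → Larger U W
    join-mixed {A = A} {B} {C} {v} t eq W⊆U v∈U v∉W (p , q , p∈A , q∈A , pv , vq) =
      join t eq W⊆U v∈U v∉W
        -- `fits` needs a vertex from each of `B` and `C`; nonemptiness supplies the other one.
        (λ b∈B → proj₁ (fits b∈B (proj₂ c∈C))) (λ c∈C → proj₂ (fits (proj₂ b∈B) c∈C))
      where
      open Triangle t

      fits : ∀ {b c} → b ∈ B → c ∈ C → Arc v b × Arc c v
      fits b∈B c∈C = mixed-fits pv vq (A⇒B p∈A b∈B) (A⇒B q∈A b∈B) (B⇒C b∈B c∈C)
                                (C⇒A c∈C p∈A) (C⇒A c∈C q∈A)

    -- If `v` is mixed over no single part, it is a source or a sink over each, but not uniformly
    -- so. Then in cyclic order some part dominated by `v` is followed by one dominating `v`, and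
    -- `v` joins the third.
    absorb : ∀ {U A B C v} → Triangle A B C → A ∪ B ∪ C ⊆ U → v ∈ U → v ∉ A ∪ B ∪ C →
             Mixed v (A ∪ B ∪ C) → Larger U (A ∪ B ∪ C)
    absorb {A = A} {B} {C} {v} t W⊆U v∈U v∉W (p , q , p∈W , q∈W , pv , vq)
      with profile {v} {A} (v∉W ∘ ∈₁ A B C) | profile {v} {B} (v∉W ∘ ∈₂ A B C)
         | profile {v} {C} (v∉W ∘ ∈₃ A B C)
    ... | inj₂ (inj₂ m) | _ | _ = join-mixed t refl W⊆U v∈U v∉W m
    ... | _ | inj₂ (inj₂ m) | _ =
          join-mixed (rotate t) (∪-rotate A B C) W⊆U v∈U v∉W m
    ... | _ | _ | inj₂ (inj₂ m) =
          join-mixed (rotate (rotate t)) (trans (∪-rotate B C A) (∪-rotate A B C)) W⊆U v∈U v∉W m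
    ... | _ | inj₁ v⇒B | inj₂ (inj₁ C⇒v) = join t refl W⊆U v∈U v∉W v⇒B C⇒v
    ... | inj₂ (inj₁ A⇒v) | _ | inj₁ v⇒C =
          join (rotate t) (∪-rotate A B C) W⊆U v∈U v∉W v⇒C A⇒v
    ... | inj₁ v⇒A | inj₂ (inj₁ B⇒v) | _ =
          join (rotate (rotate t)) (trans (∪-rotate B C A) (∪-rotate A B C)) W⊆U v∈U v∉W v⇒A B⇒v
    ... | inj₁ v⇒A | inj₁ v⇒B | inj₁ v⇒C = explode (asym pv (∪₃-elim A B C p∈W v⇒A v⇒B v⇒C))
    ... | inj₂ (inj₁ A⇒v) | inj₂ (inj₁ B⇒v) | inj₂ (inj₁ C⇒v) =
          explode (asym vq (∪₃-elim A B C q∈W A⇒v B⇒v C⇒v))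

    -- Maximal growth and the recursive decomposition

    grow : ∀ {U A B C} → Acc _⊃_ (A ∪ B ∪ C) → Triangle A B C → A ∪ B ∪ C ⊆ U → Splitting U
    grow {U} {A} {B} {C} (acc rec) t W⊆U
      with any? (λ v → v ∈? U ×-dec ¬? (v ∈? A ∪ B ∪ C) ×-dec mixed? v (A ∪ B ∪ C))
         | any? (λ v → v ∈? U ×-dec ¬? (v ∈? A ∪ B ∪ C))
    ... | yes (v , v∈U , v∉W , m) | _ = case absorb t W⊆U v∈U v∉W m of λ where
          (larger t′ W⊂W′ W′⊆U) → grow (rec W⊂W′) t′ W′⊆U
    -- Absence of mixed outside vertices is exactly the module condition.
    ... | no ¬mixed | yes (x , x∈U , x∉W) = case extend-module W⊆U (∈₁ A B C (proj₂ a∈A))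
              (λ v∈U v∉W p∈W q∈W pv vq → ¬mixed (_ , v∈U , v∉W , _ , _ , p∈W , q∈W , pv , vq))
              x∈U x∉W of λ where
          (inj₁ s) → s
          (inj₂ (larger t′ W⊂W′ W′⊆U)) → grow (rec W⊂W′) t′ W′⊆U
      where open Triangle t
    ... | no _ | no ¬outside = subst Splitting (⊆-antisym W⊆U U⊆W) (splitting-of-triangle t)
      where
      U⊆W : U ⊆ A ∪ B ∪ C
      U⊆W {x} x∈U with x ∈? A ∪ B ∪ C
      ... | yes x∈W = x∈W
      ... | no x∉W  = explode (¬outside (x , x∈U , x∉W))

    singleton-module : ∀ {U} x → Module U ⁅ x ⁆
    singleton-module x _ _ p∈ q∈ pv vq =
      asym pv (subst (Arc _) (trans (x∈⁅y⁆⇒x≡y x q∈) (sym (x∈⁅y⁆⇒x≡y x p∈))) vq)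

    splits : ∀ {U x y} → x ∈ U → y ∈ U → y ∉ ⁅ x ⁆ → Splitting U
    splits {U} {x} x∈U y∈U y∉x
      with extend-module (∈⁅⁆-subst (_∈ U) x∈U) (x∈⁅x⁆ x) (singleton-module x) y∈U y∉x
    ... | inj₁ s                = s
    ... | inj₂ (larger t _ W⊆U) = grow (⊃-wellFounded _) t W⊆U

    -- The excluded copies are copies in all of `T`, so the same hypotheses serve every part, and
    -- the parts shrink strictly.
    decompose : ∀ {U} → Acc _⊂_ U → DecomposableOn T U
    decompose {U} (acc rec) with any? (λ x → any? λ y → x ∈? U ×-dec y ∈? U ×-dec ¬? (y ∈? ⁅ x ⁆))
    ... | yes (x , y , x∈U , y∈U , y∉x) =
          split (two-elements x∈U y∈U (λ { refl → y∉x (x∈⁅x⁆ x) }))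
            A B C A⊂U B⊂U C⊂U (empty A⇒B) (empty B⇒C) (empty C⇒A) union
            (decompose (rec A⊂U)) (decompose (rec B⊂U)) (decompose (rec C⊂U)) A⇒B B⇒C C⇒A
      where
      open Splitting (splits x∈U y∈U y∉x)

      empty : ∀ {X Y} → AllArcs T X Y → Empty (X ∩ Y)
      empty {X} {Y} X⇒Y (z , z∈) = let z∈X , z∈Y = x∈p∩q⁻ X Y z∈ in disjoint X⇒Y z∈X z∈Y
    ... | no ¬two = small (case nonempty? U of λ where
          (yes (x , x∈U)) → ≤-trans (p⊆q⇒∣p∣≤∣q∣ (⊆⁅⁆ x∈U)) (≤-reflexive (∣⁅x⁆∣≡1 x))
          (no ¬x) → subst (λ V → ∣ V ∣ ≤ 1) (sym (Empty-unique ¬x))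
                      (≤-trans (≤-reflexive (∣⊥∣≡0 n)) z≤n))
      where
      ⊆⁅⁆ : ∀ {x} → x ∈ U → U ⊆ ⁅ x ⁆
      ⊆⁅⁆ {x} x∈U {y} y∈U with y ∈? ⁅ x ⁆
      ... | yes y∈ = y∈
      ... | no y∉  = explode (¬two (x , y , x∈U , y∈U , y∉))

theorem6p10 : ∀ (n : ℕ) (T : Tournament n) →
    C₃-Decomposable T ⇔ (¬ HasCopy T₅⁸ T × ¬ HasCopy T₅¹⁰ T × ¬ HasCopy T₅¹² T)
theorem6p10 n T = mk⇔
  (λ d → decomposable⇒¬copy {S = T₅⁸} rigid₈ d
       , decomposable⇒¬copy {S = T₅¹⁰} rigid₁₀ d
       , decomposable⇒¬copy {S = T₅¹²} rigid₁₂ d)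
  (λ (no₈ , no₁₀ , no₁₂) → decompose T no₈ no₁₀ no₁₂ (⊂-wellFounded ⊤))
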